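{- Let $\gamma \geq 0$ be an integer and let $\mathcal{M}$ be a unital $\gamma$-multiprojection algebra of height $h$, with unit $\mathbf{1}$ and endomorphisms $\pi_a$, $a \in [\gamma]$. Let $\mathrm{M}(\mathcal{M})$ be the $\gamma$-pluriassociative algebra constructed from $\mathcal{M}$. Then: (i) for any $a \in [h]$, $\mathbf{1}$ is an $a$-bar-unit of $\mathrm{M}(\mathcal{M})$; (ii) for any $a \leq b \in [h]$, $\mathrm{Halo}_a(\mathrm{M}(\mathcal{M}))$ is a subset of $\mathrm{Halo}_b(\mathrm{M}(\mathcal{M}))$; (iii) for any $a \in [h]$, the linear span of $\mathrm{Halo}_a(\mathrm{M}(\mathcal{M}))$ forms an $(h - a + 1)$-pluriassociative subalgebra of the $(h - a + 1)$-pluriassociative subalgebra of $\mathrm{M}(\mathcal{M})$ induced by $[a, h]$; (iv) for any $a \in [h]$, $\pi_a$ is the identity map if and only if $\mathbf{1}$ is an $a$-wire-unit of $\mathrm{M}(\mathcal{M})$.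
   Context: The ground field has characteristic zero; $[n] = \{1, \dots, n\}$; $[a, h]$ is the set of integers from $a$ to $h$; $a \uparrow a' := \max(a, a')$. A $\gamma$-multiassociative algebra is a vector space $\mathcal{M}$ with bilinear operations $\star_a$, $a \in [\gamma]$, satisfying $(x \star_a y) \star_b z = (x \star_b y) \star_{a'} z = x \star_{a''} (y \star_b z) = x \star_b (y \star_{a'''} z)$ for all $x, y, z \in \mathcal{M}$ and $a, a', a'', a''' \leq b \in [\gamma]$. An $a$-unit is an element $\mathbf{1}$ with $\mathbf{1} \star_a x = x = x \star_a \mathbf{1}$ for all $x$; a unit is an $a$-unit for some $a \in [\gamma]$. Such an algebra has at most one unit, and if this unit is a $b$-unit then it is an $a$-unit for all $a \in [b]$; the height is $0$ if there is no unit, and otherwise the greatest $h \in [\gamma]$ such that the unit is an $h$-unit. A $\gamma$-multiprojection algebra is a $\gamma$-multiassociative algebra with endomorphisms $\pi_a$, $a \in [\gamma]$ (linear maps commuting with all $\star_b$), satisfying $\pi_a \circ \pi_{a'} = \pi_{a \uparrow a'}$ for all $a, a' \in [\gamma]$. Its height is its height as a $\gamma$-multiassociative algebra. It is unital if it has a unit $\mathbf{1}$ as a $\gamma$-multiassociative algebra and $\pi_a(\mathbf{1}) = \mathbf{1}$ for all $a \in [h]$, where $h$ is its height. $\mathrm{M}(\mathcal{M})$ is the vector space $\mathcal{M}$ with the operations $x \dashv_a y := x \star_a \pi_a(y)$ and $x \vdash_a y := \pi_a(x) \star_a y$, $a \in [\gamma]$. It is a $\gamma$-pluriassociative algebra,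 that is, for all $x, y, z$ and $a, a' \in [\gamma]$: $(x \vdash_{a'} y) \dashv_a z = x \vdash_{a'} (y \dashv_a z)$; $(x \dashv_{a \uparrow a'} y) \dashv_a z = x \dashv_a (y \vdash_{a'} z)$; $(x \dashv_{a'} y) \vdash_a z = x \vdash_a (y \vdash_{a \uparrow a'} z)$; $(x \dashv_a y) \dashv_{a \uparrow a'} z = x \dashv_a (y \dashv_{a'} z)$; $(x \vdash_{a'} y) \vdash_a z = x \vdash_{a \uparrow a'} (y \vdash_a z)$. In a $\gamma$-pluriassociative algebra $\mathcal{P}$: an $a$-bar-unit is an element $e$ with $x \dashv_a e = x = e \vdash_a x$ for all $x$; the $a$-halo $\mathrm{Halo}_a(\mathcal{P})$ is the set of $a$-bar-units; an $a$-wire-unit is an element $e$ with $e \dashv_a x = x = x \vdash_a e$ for all $x$. For $C \subseteq [\gamma]$, the $\#C$-pluriassociative subalgebra of $\mathcal{P}$ induced by $C$ is the vector space $\mathcal{P}$ with only the operations $\dashv_c, \vdash_c$, $c \in C$, renumbered from $1$ to $\#C$ respecting their relative order. A subalgebra is a subspace stable under all the operations. -}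

module Defs where

open import Level using (Level; _⊔_) renaming (suc to lsuc)
open import Algebra.Apartness.Bundles using (HeytingField; HeytingCommutativeRing)
open import Algebra.Bundles using (CommutativeRing)
open import Algebra.Module.Bundles using (Module)
open import Algebra.Module.Morphism.Structures using (IsModuleHomomorphism)
import Algebra.Construct.NaturalChoice.Max as Max
import Algebra.Definitions.RawMonoid as RawMonoidDefinitions
import Algebra.Module.Morphism.Construct.Composition as Composition
open import Data.Fin.Base using (Fin; zero; suc; toℕ; _≤_)
open import Data.Fin.Properties using (≤-total; ≤-totalOrder; ≤-refl; _≤?_)
open import Data.Fin.Subset using (Subset; inside; outside; ∣_∣)
open import Data.Nat.Base as ℕ using (ℕ; zero; suc; z≤n; s≤s)
import Data.Nat.Properties as ℕ
open import Data.Product.Base using (_×_; _,_; ∃-syntax; Σ-syntax)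
open import Data.Sum.Base using (_⊎_; inj₁; inj₂)
open import Data.Vec.Base using ([]; _∷_; tabulate)
open import Data.Vec.Functional using (Vector; zipWith)
open import Relation.Binary.PropositionalEquality as ≡ using (_≡_)
open import Relation.Nullary.Decidable using (does; _×-dec_)
open import Relation.Nullary.Negation using (¬_)
open import Relation.Unary using (Pred)

-- The set [γ] = {1, …, γ} is represented by Fin γ: the element a of
-- Fin γ stands for the integer suc (toℕ a).

infix 4 _∈[_]

_∈[_] : ∀ {γ} → Fin γ → ℕ → Set
a ∈[ h ] = suc (toℕ a) ℕ.≤ h

infixl 6 _↑_

_↑_ : ∀ {γ} → Fin γ → Fin γ → Fin γ
_↑_ {γ} = Max._⊔_ (≤-totalOrder γ)

interval : ∀ {γ} → Fin γ → ℕ → Subset γ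
interval a h = tabulate λ c → does ((a ≤? c) ×-dec (toℕ c ℕ.<? h))

-- The increasing enumeration of the elements of C.
enumerate : ∀ {γ} (C : Subset γ) → Fin ∣ C ∣ → Fin γ
enumerate (inside  ∷ C) zero    = zero
enumerate (inside  ∷ C) (suc i) = suc (enumerate C i)
enumerate (outside ∷ C) i       = suc (enumerate C i)

enumerate-mono : ∀ {γ} (C : Subset γ) {i j : Fin ∣ C ∣} →
                 i ≤ j → enumerate C i ≤ enumerate C j
enumerate-mono (inside  ∷ C) {zero}  {j}     _       = z≤n
enumerate-mono (inside  ∷ C) {suc i} {suc j} (s≤s p) = s≤s (enumerate-mono C p)
enumerate-mono (outside ∷ C)                 p       = s≤s (enumerate-mono C p)

enumerate-↑ : ∀ {γ} (C : Subset γ) (i j : Fin ∣ C ∣) →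
              enumerate C (i ↑ j) ≡ enumerate C i ↑ enumerate C j
enumerate-↑ {γ} C i j with ≤-total i j
... | inj₁ i≤j = ≡.trans
  (≡.cong (enumerate C) (Max.x≤y⇒x⊔y≈y (≤-totalOrder ∣ C ∣) i≤j))
  (≡.sym (Max.x≤y⇒x⊔y≈y (≤-totalOrder γ) (enumerate-mono C i≤j)))
... | inj₂ j≤i = ≡.trans
  (≡.cong (enumerate C) (Max.x≤y⇒y⊔x≈y (≤-totalOrder ∣ C ∣) j≤i))
  (≡.sym (Max.x≤y⇒y⊔x≈y (≤-totalOrder γ) (enumerate-mono C j≤i)))

module _ {c ℓ₁ ℓ₂ : Level} (K : HeytingField c ℓ₁ ℓ₂) where

  CharacteristicZero : Set ℓ₁
  CharacteristicZero = ∀ n → ¬ (suc n ×ᴷ 1# ≈ 0#)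
    where
    open HeytingField K
    open RawMonoidDefinitions
      (CommutativeRing.+-rawMonoid
        (HeytingCommutativeRing.commutativeRing heytingCommutativeRing))
      renaming (_×_ to _×ᴷ_)

  VectorSpace : (m ℓm : Level) → Set (c ⊔ ℓ₁ ⊔ lsuc (m ⊔ ℓm))
  VectorSpace = Module (HeytingCommutativeRing.commutativeRing
                         (HeytingField.heytingCommutativeRing K))

module _ {c ℓ m ℓm : Level} {R : CommutativeRing c ℓ} (V : Module R m ℓm) where

  open CommutativeRing R using (Carrier)
  open Module V
  open RawMonoidDefinitions +ᴹ-rawMonoid using (sum)

  IsLinear : (Carrierᴹ → Carrierᴹ) → Set (c ⊔ m ⊔ ℓm)
  IsLinear = IsModuleHomomorphism rawModule rawModule

  record IsBilinear (_∙_ : Carrierᴹ → Carrierᴹ → Carrierᴹ) : Set (c ⊔ m ⊔ ℓm) where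
    field
      linearˡ : ∀ y → IsLinear (λ x → x ∙ y)
      linearʳ : ∀ x → IsLinear (λ y → x ∙ y)

  record IsSubmodule {p : Level} (S : Pred Carrierᴹ p) : Set (c ⊔ m ⊔ ℓm ⊔ p) where
    field
      respects  : ∀ {x y} → x ≈ᴹ y → S x → S y
      0ᴹ-closed : S 0ᴹ
      +ᴹ-closed : ∀ {x y} → S x → S y → S (x +ᴹ y)
      *ₗ-closed : ∀ k {x} → S x → S (k *ₗ x)

  Span : {p : Level} → Pred Carrierᴹ p → Pred Carrierᴹ (c ⊔ m ⊔ ℓm ⊔ p)
  Span S x = ∃[ n ] Σ[ k ∈ Vector Carrier n ] Σ[ v ∈ Vector Carrierᴹ n ]
    (∀ i → S (v i)) × x ≈ᴹ sum (zipWith _*ₗ_ k v)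

module _ {c ℓ₁ ℓ₂ : Level} (K : HeytingField c ℓ₁ ℓ₂) (γ : ℕ) (m ℓm : Level) where

  record MultiassociativeAlgebra : Set (c ⊔ ℓ₁ ⊔ lsuc (m ⊔ ℓm)) where
    infix 7 _⋆⟨_⟩_
    field
      vectorSpace : VectorSpace K m ℓm

    open Module vectorSpace public

    field
      _⋆⟨_⟩_     : Carrierᴹ → Fin γ → Carrierᴹ → Carrierᴹ
      ⋆-bilinear : ∀ a → IsBilinear vectorSpace (_⋆⟨ a ⟩_)
      ⋆-assoc    : ∀ {a a′ a″ a‴ b} → a ≤ b → a′ ≤ b → a″ ≤ b → a‴ ≤ b → ∀ x y z →
        ((x ⋆⟨ a ⟩ y) ⋆⟨ b ⟩ z ≈ᴹ (x ⋆⟨ b ⟩ y) ⋆⟨ a′ ⟩ z) ×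
        ((x ⋆⟨ b ⟩ y) ⋆⟨ a′ ⟩ z ≈ᴹ x ⋆⟨ a″ ⟩ (y ⋆⟨ b ⟩ z)) ×
        (x ⋆⟨ a″ ⟩ (y ⋆⟨ b ⟩ z) ≈ᴹ x ⋆⟨ b ⟩ (y ⋆⟨ a‴ ⟩ z))

    ⋆-cong : ∀ {a x x′ y y′} → x ≈ᴹ x′ → y ≈ᴹ y′ → x ⋆⟨ a ⟩ y ≈ᴹ x′ ⋆⟨ a ⟩ y′
    ⋆-cong {a} p q = ≈ᴹ-trans
      (IsModuleHomomorphism.⟦⟧-cong (IsBilinear.linearˡ (⋆-bilinear a) _) p)
      (IsModuleHomomorphism.⟦⟧-cong (IsBilinear.linearʳ (⋆-bilinear a) _) q)

    IsUnitAt : Fin γ → Pred Carrierᴹ (m ⊔ ℓm)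
    IsUnitAt a e = ∀ x → (e ⋆⟨ a ⟩ x ≈ᴹ x) × (x ⋆⟨ a ⟩ e ≈ᴹ x)

    IsUnit : Pred Carrierᴹ (m ⊔ ℓm)
    IsUnit e = ∃[ a ] IsUnitAt a e

    -- A relation rather than a function, since whether a unit exists is
    -- not decidable.  In the second alternative h is the element of [γ]
    -- represented by k.
    HasHeight : ℕ → Set (m ⊔ ℓm)
    HasHeight h =
      (h ≡ 0 × ¬ (∃[ e ] IsUnit e)) ⊎
      (∃[ e ] ∃[ k ] h ≡ suc (toℕ k) × IsUnitAt k e × (∀ a → IsUnitAt a e → a ≤ k))

  record MultiprojectionAlgebra : Set (c ⊔ ℓ₁ ⊔ lsuc (m ⊔ ℓm)) where
    field
      multiassociativeAlgebra : MultiassociativeAlgebra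

    open MultiassociativeAlgebra multiassociativeAlgebra public

    field
      π        : Fin γ → Carrierᴹ → Carrierᴹ
      π-linear : ∀ a → IsLinear vectorSpace (π a)
      π-⋆      : ∀ a b x y → π a (x ⋆⟨ b ⟩ y) ≈ᴹ π a x ⋆⟨ b ⟩ π a y
      π-π      : ∀ a a′ x → π a (π a′ x) ≈ᴹ π (a ↑ a′) x

    record IsUnitalWith (𝟏 : Carrierᴹ) : Set (m ⊔ ℓm) where
      field
        isUnit : IsUnit 𝟏
        π-𝟏    : ∀ {h} → HasHeight h → ∀ a → a ∈[ h ] → π a 𝟏 ≈ᴹ 𝟏

  record PluriassociativeAlgebra : Set (c ⊔ ℓ₁ ⊔ lsuc (m ⊔ ℓm)) where
    infix 7 _⊣⟨_⟩_ _⊢⟨_⟩_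
    field
      vectorSpace : VectorSpace K m ℓm

    open Module vectorSpace public

    field
      _⊣⟨_⟩_ _⊢⟨_⟩_ : Carrierᴹ → Fin γ → Carrierᴹ → Carrierᴹ
      ⊣-bilinear    : ∀ a → IsBilinear vectorSpace (_⊣⟨ a ⟩_)
      ⊢-bilinear    : ∀ a → IsBilinear vectorSpace (_⊢⟨ a ⟩_)
      ⊢-⊣ : ∀ a a′ x y z → (x ⊢⟨ a′ ⟩ y) ⊣⟨ a ⟩ z ≈ᴹ x ⊢⟨ a′ ⟩ (y ⊣⟨ a ⟩ z)
      ⊣-⊢ : ∀ a a′ x y z → (x ⊣⟨ a ↑ a′ ⟩ y) ⊣⟨ a ⟩ z ≈ᴹ x ⊣⟨ a ⟩ (y ⊢⟨ a′ ⟩ z)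
      ⊢-↑ : ∀ a a′ x y z → (x ⊣⟨ a′ ⟩ y) ⊢⟨ a ⟩ z ≈ᴹ x ⊢⟨ a ⟩ (y ⊢⟨ a ↑ a′ ⟩ z)
      ⊣-⊣ : ∀ a a′ x y z → (x ⊣⟨ a ⟩ y) ⊣⟨ a ↑ a′ ⟩ z ≈ᴹ x ⊣⟨ a ⟩ (y ⊣⟨ a′ ⟩ z)
      ⊢-⊢ : ∀ a a′ x y z → (x ⊢⟨ a′ ⟩ y) ⊢⟨ a ⟩ z ≈ᴹ x ⊢⟨ a ↑ a′ ⟩ (y ⊢⟨ a ⟩ z)

    IsBarUnit : Fin γ → Pred Carrierᴹ (m ⊔ ℓm)
    IsBarUnit a e = ∀ x → (x ⊣⟨ a ⟩ e ≈ᴹ x) × (e ⊢⟨ a ⟩ x ≈ᴹ x)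

    Halo : Fin γ → Pred Carrierᴹ (m ⊔ ℓm)
    Halo a e = IsBarUnit a e

    IsWireUnit : Fin γ → Pred Carrierᴹ (m ⊔ ℓm)
    IsWireUnit a e = ∀ x → (e ⊣⟨ a ⟩ x ≈ᴹ x) × (x ⊢⟨ a ⟩ e ≈ᴹ x)

    record IsSubalgebra {p : Level} (S : Pred Carrierᴹ p) : Set (c ⊔ m ⊔ ℓm ⊔ p) where
      field
        isSubmodule : IsSubmodule vectorSpace S
        ⊣-closed    : ∀ a {x y} → S x → S y → S (x ⊣⟨ a ⟩ y)
        ⊢-closed    : ∀ a {x y} → S x → S y → S (x ⊢⟨ a ⟩ y)

open PluriassociativeAlgebra public
  using (IsBarUnit; IsWireUnit; Halo; IsSubalgebra)

module _ {c ℓ₁ ℓ₂ m ℓm : Level} {K : HeytingField c ℓ₁ ℓ₂} {γ : ℕ} where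

  -- The #C-pluriassociative subalgebra of 𝓟 induced by C.
  induced : PluriassociativeAlgebra K γ m ℓm → (C : Subset γ) →
            PluriassociativeAlgebra K ∣ C ∣ m ℓm
  induced 𝓟 C = record
    { vectorSpace = vectorSpace
    ; _⊣⟨_⟩_      = λ x i y → x ⊣⟨ ι i ⟩ y
    ; _⊢⟨_⟩_      = λ x i y → x ⊢⟨ ι i ⟩ y
    ; ⊣-bilinear  = λ i → ⊣-bilinear (ι i)
    ; ⊢-bilinear  = λ i → ⊢-bilinear (ι i)
    ; ⊢-⊣         = λ i j → ⊢-⊣ (ι i) (ι j)
    ; ⊣-⊢         = λ i j x y z → ≡.subst
        (λ b → (x ⊣⟨ b ⟩ y) ⊣⟨ ι i ⟩ z ≈ᴹ x ⊣⟨ ι i ⟩ (y ⊢⟨ ι j ⟩ z))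
        (ι-↑ i j) (⊣-⊢ (ι i) (ι j) x y z)
    ; ⊢-↑         = λ i j x y z → ≡.subst
        (λ b → (x ⊣⟨ ι j ⟩ y) ⊢⟨ ι i ⟩ z ≈ᴹ x ⊢⟨ ι i ⟩ (y ⊢⟨ b ⟩ z))
        (ι-↑ i j) (⊢-↑ (ι i) (ι j) x y z)
    ; ⊣-⊣         = λ i j x y z → ≡.subst
        (λ b → (x ⊣⟨ ι i ⟩ y) ⊣⟨ b ⟩ z ≈ᴹ x ⊣⟨ ι i ⟩ (y ⊣⟨ ι j ⟩ z))
        (ι-↑ i j) (⊣-⊣ (ι i) (ι j) x y z)
    ; ⊢-⊢         = λ i j x y z → ≡.subst
        (λ b → (x ⊢⟨ ι j ⟩ y) ⊢⟨ ι i ⟩ z ≈ᴹ x ⊢⟨ b ⟩ (y ⊢⟨ ι i ⟩ z))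
        (ι-↑ i j) (⊢-⊢ (ι i) (ι j) x y z)
    }
    where
    open PluriassociativeAlgebra 𝓟
    ι : Fin ∣ C ∣ → Fin γ
    ι = enumerate C
    ι-↑ : ∀ i j → ι i ↑ ι j ≡ ι (i ↑ j)
    ι-↑ i j = ≡.sym (enumerate-↑ C i j)

  M : MultiprojectionAlgebra K γ m ℓm → PluriassociativeAlgebra K γ m ℓm
  M 𝓜 = record
    { vectorSpace = vectorSpace
    ; _⊣⟨_⟩_      = λ x a y → x ⋆⟨ a ⟩ π a y
    ; _⊢⟨_⟩_      = λ x a y → π a x ⋆⟨ a ⟩ y
    ; ⊣-bilinear  = λ a → record
      { linearˡ = λ y → IsBilinear.linearˡ (⋆-bilinear a) (π a y)
      ; linearʳ = λ x → Composition.isModuleHomomorphism ≈ᴹ-trans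
                          (π-linear a) (IsBilinear.linearʳ (⋆-bilinear a) x)
      }
    ; ⊢-bilinear  = λ a → record
      { linearˡ = λ y → Composition.isModuleHomomorphism ≈ᴹ-trans
                          (π-linear a) (IsBilinear.linearˡ (⋆-bilinear a) y)
      ; linearʳ = λ x → IsBilinear.linearʳ (⋆-bilinear a) (π a x)
      }
    ; ⊢-⊣ = λ a a′ x y z → reassoc ≡.refl
    ; ⊣-⊢ = λ a a′ x y z → ≈ᴹ-trans
        (reassoc (≡.trans (↑-comm (a ↑ a′) a) (↑-absorb a a′)))
        (⋆-cong ≈ᴹ-refl
          (≈ᴹ-sym (≈ᴹ-trans (π-⋆ a a′ (π a′ y) z) (⋆-cong (π-π a a′ y) ≈ᴹ-refl))))
    ; ⊢-↑ = λ a a′ x y z → ≈ᴹ-trans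
        (⋆-cong (≈ᴹ-trans (π-⋆ a a′ x (π a′ y)) (⋆-cong ≈ᴹ-refl (π-π a a′ y))) ≈ᴹ-refl)
        (reassoc (≡.trans (↑-comm a′ a) (≡.sym (↑-absorb a a′))))
    ; ⊣-⊣ = λ a a′ x y z → ≈ᴹ-trans
        (reassoc (↑-absorb a a′))
        (⋆-cong ≈ᴹ-refl
          (≈ᴹ-sym (≈ᴹ-trans (π-⋆ a a′ y (π a′ z)) (⋆-cong ≈ᴹ-refl (π-π a a′ z)))))
    ; ⊢-⊢ = λ a a′ x y z → ≈ᴹ-trans
        (⋆-cong (≈ᴹ-trans (π-⋆ a a′ (π a′ x) y) (⋆-cong (π-π a a′ x) ≈ᴹ-refl)) ≈ᴹ-refl)
        (reassoc (≡.trans (↑-comm a′ a)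
          (≡.sym (≡.trans (↑-comm (a ↑ a′) a) (↑-absorb a a′)))))
    }
    where
    open MultiprojectionAlgebra 𝓜
    open Max (≤-totalOrder γ) using (x≤y⇒x⊔y≈y; x≤y⇒y⊔x≈y)
      renaming (⊔-comm to ↑-comm; ⊔-assoc to ↑-assoc; ⊔-idem to ↑-idem)

    ↑-absorb : ∀ a a′ → a ↑ (a ↑ a′) ≡ a ↑ a′
    ↑-absorb a a′ = ≡.trans (≡.sym (↑-assoc a a a′)) (≡.cong (_↑ a′) (↑-idem a))

    -- Both bracketings depend only on the maximum of the two indices.
    normalˡ : ∀ a b x y z →
              (x ⋆⟨ a ⟩ y) ⋆⟨ b ⟩ z ≈ᴹ (x ⋆⟨ a ↑ b ⟩ y) ⋆⟨ a ↑ b ⟩ z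
    normalˡ a b x y z with ≤-total a b
    ... | inj₁ a≤b rewrite x≤y⇒x⊔y≈y a≤b =
      let p , _ = ⋆-assoc a≤b ≤-refl ≤-refl ≤-refl x y z in p
    ... | inj₂ b≤a rewrite x≤y⇒y⊔x≈y b≤a =
      let p , _ = ⋆-assoc ≤-refl b≤a ≤-refl ≤-refl x y z in ≈ᴹ-sym p

    normalʳ : ∀ a b x y z →
              (x ⋆⟨ a ↑ b ⟩ y) ⋆⟨ a ↑ b ⟩ z ≈ᴹ x ⋆⟨ a ⟩ (y ⋆⟨ b ⟩ z)
    normalʳ a b x y z with ≤-total a b
    ... | inj₁ a≤b rewrite x≤y⇒x⊔y≈y a≤b =
      let _ , p , _ = ⋆-assoc ≤-refl ≤-refl a≤b ≤-refl x y z in p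
    ... | inj₂ b≤a rewrite x≤y⇒y⊔x≈y b≤a =
      let _ , p , q = ⋆-assoc ≤-refl ≤-refl ≤-refl b≤a x y z in ≈ᴹ-trans p q

    reassoc : ∀ {a b a′ b′ x y z} → a ↑ b ≡ a′ ↑ b′ →
              (x ⋆⟨ a ⟩ y) ⋆⟨ b ⟩ z ≈ᴹ x ⋆⟨ a′ ⟩ (y ⋆⟨ b′ ⟩ z)
    reassoc {a} {b} {a′} {b′} {x} {y} {z} eq = ≈ᴹ-trans (normalˡ a b x y z)
      (≡.subst (λ d → (x ⋆⟨ d ⟩ y) ⋆⟨ d ⟩ z ≈ᴹ x ⋆⟨ a′ ⟩ (y ⋆⟨ b′ ⟩ z))
        (≡.sym eq) (normalʳ a′ b′ x y z))

{-# OPTIONS --safe #-}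

-- For a ≤ h, e is an a-bar-unit exactly when π_a e is a unit for ⋆_a, that
-- is, when π_a e = 𝟏.  Since π_b ∘ π_a = π_b and π_b 𝟏 = 𝟏, Halo_a is
-- contained in Halo_b for a ≤ b ≤ h.  By linearity, for y in the span of
-- Halo_a and c ∈ [a, h], both x ⊣_c y and y ⊢_c x are scalar multiples of
-- x, so the span is stable.
module Submission where

open import Defs
open import Algebra.Apartness.Bundles using (HeytingField)
open import Algebra.Bundles using (CommutativeRing)
import Algebra.Construct.NaturalChoice.Max as Max
import Algebra.Definitions.RawMonoid as RawMonoidDefinitions
open import Algebra.Module.Bundles using (Module)
open import Algebra.Module.Morphism.Structures using (IsModuleHomomorphism)
open import Data.Bool.Properties using (T-≡)
open import Data.Fin.Base using (Fin; zero; suc; toℕ; _≤_)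
open import Data.Fin.Properties using (≤-refl; ≤-total; ≤-totalOrder; _≤?_; toℕ<n)
open import Data.Fin.Subset using (Subset; inside; outside; _∈_; ∣_∣)
open import Data.Nat.Base as ℕ using (ℕ; zero; suc; z≤n; s≤s; _+_; _∸_)
import Data.Nat.Properties as ℕ
open import Data.Product.Base using (_×_; _,_; proj₁; proj₂; ∃-syntax)
open import Data.Sum.Base using (inj₁; inj₂)
open import Data.Vec.Base using (_∷_; here; there; tabulate)
open import Data.Vec.Properties using ([]=⇒lookup; lookup∘tabulate; tabulate-cong)
import Data.Vec.Functional as Vector
open import Function.Base using (_∘_)
open import Function.Bundles using (_⇔_; Equivalence; mk⇔)
open import Level using (Level)
open import Relation.Binary.PropositionalEquality as ≡ using (_≡_)
open import Relation.Nullary.Decidable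
  using (Dec; does; toWitness; isYes≗does; does-⇔; _×-dec_)
open import Relation.Nullary.Negation using (contradiction)
open import Relation.Unary using (Pred; _⊆_)

-- Enumerations and sizes of intervals

enumerate-∈ : ∀ {γ} (C : Subset γ) i → enumerate C i ∈ C
enumerate-∈ (inside  ∷ C) zero    = here
enumerate-∈ (inside  ∷ C) (suc i) = there (enumerate-∈ C i)
enumerate-∈ (outside ∷ C) i       = there (enumerate-∈ C i)

-- Looking up `c` in the tabulation returns the Boolean of the decision `c?`; membership says that
-- it is true, so the bounds are recovered as its witness.
∈interval⇒bounds : ∀ {γ} {a c : Fin γ} {h} →
                   c ∈ interval a h → a ≤ c × c ∈[ h ]
∈interval⇒bounds {a = a} {c} {h} c∈ = toWitness {a? = c?} (Equivalence.from T-≡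
  (≡.trans (isYes≗does c?) (≡.trans (≡.sym (lookup∘tabulate _ c)) ([]=⇒lookup c∈))))
  where
  c? : Dec (a ≤ c × c ∈[ h ])
  c? = (a ≤? c) ×-dec (toℕ c ℕ.<? h)

∣tabulate-false∣≡0 : ∀ n → ∣ tabulate {n = n} (λ _ → outside) ∣ ≡ 0
∣tabulate-false∣≡0 zero    = ≡.refl
∣tabulate-false∣≡0 (suc n) = ∣tabulate-false∣≡0 n

∣tabulate-<?∣ : ∀ {γ h} → h ℕ.≤ γ →
                ∣ tabulate {n = γ} (λ c → does (toℕ c ℕ.<? h)) ∣ ≡ h
∣tabulate-<?∣ {γ} z≤n       = ∣tabulate-false∣≡0 γ
∣tabulate-<?∣     (s≤s h≤γ) = ≡.cong suc (∣tabulate-<?∣ h≤γ)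

∣interval∣ : ∀ {γ} (a : Fin γ) {h} → a ∈[ h ] → h ℕ.≤ γ →
             ∣ interval a h ∣ ≡ (h ∸ suc (toℕ a)) + 1
∣interval∣ zero {suc h} _ h≤γ =
  -- From `zero` on, the lower bound always holds, so only the elements below the upper bound are
  -- counted.
  ≡.trans (∣tabulate-<?∣ h≤γ) (ℕ.+-comm 1 h)
∣interval∣ {suc γ} (suc a) {suc h} (s≤s a<h) (s≤s h≤γ) =
  -- The head lies below `suc a` and counts for nothing; the tail is the interval with both ends
  -- lowered by one.
  ≡.trans (≡.cong (∣_∣ {γ}) (tabulate-cong λ c → does-⇔
    (mk⇔ (λ (p , q) → ℕ.s≤s⁻¹ p , ℕ.s≤s⁻¹ q) (λ (p , q) → s≤s p , s≤s q))
    ((suc a ≤? suc c) ×-dec (suc (toℕ c) ℕ.<? suc h))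
    ((a ≤? c) ×-dec (toℕ c ℕ.<? h))))
  (∣interval∣ a a<h h≤γ)

-- Linear spans

module _ {c ℓ m ℓm p : Level} {R : CommutativeRing c ℓ} (V : Module R m ℓm)
         (S : Pred (Module.Carrierᴹ V) p) where

  open CommutativeRing R using (Carrier; 0#; _*_)
    renaming (_+_ to _+ᴿ_)
  open Module V
  open RawMonoidDefinitions +ᴹ-rawMonoid using (sum)

  Span-respects : ∀ {x y} → x ≈ᴹ y → Span V S x → Span V S y
  Span-respects x≈y (n , k , v , v∈S , x≈) =
    n , k , v , v∈S , ≈ᴹ-trans (≈ᴹ-sym x≈y) x≈

  Span-0 : Span V S 0ᴹ
  Span-0 = 0 , (λ ()) , (λ ()) , (λ ()) , ≈ᴹ-refl

  Span-cons : ∀ k {v x} → S v → Span V S x → Span V S (k *ₗ v +ᴹ x)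
  Span-cons k {v} v∈S (n , ks , vs , vs∈S , x≈) =
    suc n , k Vector.∷ ks , v Vector.∷ vs
    , (λ { zero → v∈S ; (suc i) → vs∈S i }) , +ᴹ-congˡ x≈

  -- A linear combination is built from `0ᴹ` by adding one scaled generator at a time. With this
  -- principle later arguments need not handle coefficient vectors.
  Span-ind : ∀ {q} (P : Pred Carrierᴹ q) →
             (∀ {x y} → x ≈ᴹ y → P x → P y) → P 0ᴹ →
             (∀ k {v x} → S v → P x → P (k *ₗ v +ᴹ x)) → Span V S ⊆ P
  Span-ind P resp P0 Pcons (n , k , v , v∈S , x≈) =
    resp (≈ᴹ-sym x≈) (sum∈P n k v v∈S)
    where
    sum∈P : ∀ n k v → (∀ i → S (v i)) → P (sum {n} (Vector.zipWith _*ₗ_ k v))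
    sum∈P zero    k v v∈S = P0
    sum∈P (suc n) k v v∈S = Pcons (k zero) (v∈S zero)
      (sum∈P n (k ∘ suc) (v ∘ suc) (v∈S ∘ suc))

  Span-+ : ∀ {x y} → Span V S x → Span V S y → Span V S (x +ᴹ y)
  -- Induction on the first summand with `y` fixed replaces concatenation of the two families.
  Span-+ {y = y} x∈ y∈ = Span-ind (λ x → Span V S (x +ᴹ y))
    (λ x≈x′ → Span-respects (+ᴹ-congʳ x≈x′))
    (Span-respects (≈ᴹ-sym (+ᴹ-identityˡ y)) y∈)
    (λ k v∈S x+y∈ → Span-respects (≈ᴹ-sym (+ᴹ-assoc _ _ y)) (Span-cons k v∈S x+y∈))
    x∈

  Span-*ₗ : ∀ s {x} → Span V S x → Span V S (s *ₗ x)
  Span-*ₗ s = Span-ind (λ x → Span V S (s *ₗ x))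
    (λ x≈x′ → Span-respects (*ₗ-congˡ x≈x′))
    (Span-respects (≈ᴹ-sym (*ₗ-zeroʳ s)) Span-0)
    (λ k v∈S sx∈ → Span-respects
      (≈ᴹ-sym (≈ᴹ-trans (*ₗ-distribˡ s _ _) (+ᴹ-congʳ (≈ᴹ-sym (*ₗ-assoc s k _)))))
      (Span-cons (s * k) v∈S sx∈))

  Span-isSubmodule : IsSubmodule V (Span V S)
  Span-isSubmodule = record
    { respects  = Span-respects
    ; 0ᴹ-closed = Span-0
    ; +ᴹ-closed = Span-+
    ; *ₗ-closed = Span-*ₗ
    }

  -- If x is the sum of the kᵢ vᵢ, then f x is the sum of the kᵢ f(vᵢ), so the scalar is the sum of
  -- the coefficients.
  linear-const⇒scalar : ∀ {f} → IsLinear V f → ∀ {y} → (∀ {v} → S v → f v ≈ᴹ y) →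
                        ∀ {x} → Span V S x → ∃[ s ] f x ≈ᴹ s *ₗ y
  linear-const⇒scalar {f} f-linear {y} f≈y = Span-ind (λ x → ∃[ s ] f x ≈ᴹ s *ₗ y)
    (λ x≈x′ (s , eq) → s , ≈ᴹ-trans (⟦⟧-cong (≈ᴹ-sym x≈x′)) eq)
    (0# , ≈ᴹ-trans 0ᴹ-homo (≈ᴹ-sym (*ₗ-zeroˡ y)))
    (λ k {v} {x} v∈S (s , eq) → k +ᴿ s ,
      ≈ᴹ-trans (+ᴹ-homo (k *ₗ v) x)
        (≈ᴹ-trans (+ᴹ-cong (≈ᴹ-trans (*ₗ-homo k v) (*ₗ-congˡ (f≈y v∈S))) eq)
          (≈ᴹ-sym (*ₗ-distribʳ y k s))))
    where
    open IsModuleHomomorphism f-linear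

module _ {c ℓ₁ ℓ₂ m ℓm : Level} {K : HeytingField c ℓ₁ ℓ₂} {γ : ℕ} where

  -- Units and height

  module _ (𝓐 : MultiassociativeAlgebra K γ m ℓm) where
    open MultiassociativeAlgebra 𝓐

    -- An outer `⋆⟨ b ⟩` by `e` changes nothing, and beneath it associativity lets the inner index
    -- drop from `b` to `a`: e ⋆ₐ x = e ⋆_b (e ⋆ₐ x) = e ⋆_b (e ⋆_b x) = x, and symmetrically on the
    -- right.
    IsUnitAt-antitone : ∀ {a b e} → a ≤ b → IsUnitAt b e → IsUnitAt a e
    IsUnitAt-antitone {a} {b} {e} a≤b e-unit x =
      (let _ , _ , p = ⋆-assoc ≤-refl ≤-refl ≤-refl a≤b e e x in
       ≈ᴹ-trans (≈ᴹ-sym (eˡ (e ⋆⟨ a ⟩ x)))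
         (≈ᴹ-trans (≈ᴹ-sym p) (≈ᴹ-trans (eˡ (e ⋆⟨ b ⟩ x)) (eˡ x)))) ,
      (let p , _ = ⋆-assoc a≤b ≤-refl ≤-refl ≤-refl x e e in
       ≈ᴹ-trans (≈ᴹ-sym (eʳ (x ⋆⟨ a ⟩ e)))
         (≈ᴹ-trans p (≈ᴹ-trans (eʳ (x ⋆⟨ b ⟩ e)) (eʳ x))))
      where
      eˡ : ∀ y → e ⋆⟨ b ⟩ y ≈ᴹ y
      eˡ y = proj₁ (e-unit y)
      eʳ : ∀ y → y ⋆⟨ b ⟩ e ≈ᴹ y
      eʳ y = proj₂ (e-unit y)

    IsUnitAt-unique : ∀ {a e e′} → IsUnitAt a e → IsUnitAt a e′ → e ≈ᴹ e′
    IsUnitAt-unique {e = e} {e′} e-unit e′-unit =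
      ≈ᴹ-trans (≈ᴹ-sym (proj₂ (e′-unit e))) (proj₁ (e-unit e′))

    -- The unit with the larger index also serves at the smaller one, where the usual two-unit
    -- argument applies.
    IsUnit-unique : ∀ {e e′} → IsUnit e → IsUnit e′ → e ≈ᴹ e′
    IsUnit-unique (a , e-unit) (b , e′-unit) with ≤-total a b
    ... | inj₁ a≤b = IsUnitAt-unique e-unit (IsUnitAt-antitone a≤b e′-unit)
    ... | inj₂ b≤a = IsUnitAt-unique (IsUnitAt-antitone b≤a e-unit) e′-unit

    IsUnitAt-respects : ∀ {a e e′} → e ≈ᴹ e′ → IsUnitAt a e → IsUnitAt a e′
    IsUnitAt-respects e≈e′ e-unit x =
      ≈ᴹ-trans (⋆-cong (≈ᴹ-sym e≈e′) ≈ᴹ-refl) (proj₁ (e-unit x)) ,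
      ≈ᴹ-trans (⋆-cong ≈ᴹ-refl (≈ᴹ-sym e≈e′)) (proj₂ (e-unit x))

    height≤γ : ∀ {h} → HasHeight h → h ℕ.≤ γ
    height≤γ (inj₁ (≡.refl , _))         = z≤n
    height≤γ (inj₂ (_ , k , ≡.refl , _)) = toℕ<n k

    -- `HasHeight` carries a unit of its own; uniqueness identifies it with `e`, and its property at
    -- the top index then descends to `a`.
    unit-below-height : ∀ {h} → HasHeight h → ∀ {e} → IsUnit e →
                        ∀ {a} → a ∈[ h ] → IsUnitAt a e
    unit-below-height (inj₁ (_ , no-unit)) e-isUnit =
      contradiction (_ , e-isUnit) no-unit
    unit-below-height (inj₂ (e′ , k , ≡.refl , e′-unit , _)) e-isUnit a∈[h] =
      IsUnitAt-antitone (ℕ.s≤s⁻¹ a∈[h])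
        (IsUnitAt-respects (IsUnit-unique (k , e′-unit) e-isUnit) e′-unit)

  -- Bar-units, halos and wire-units

  module _ (𝓜 : MultiprojectionAlgebra K γ m ℓm) where
    open MultiprojectionAlgebra 𝓜

    module _ {h : ℕ} (hasHeight : HasHeight h)
             {𝟏 : Carrierᴹ} (𝟏-unital : IsUnitalWith 𝟏) where
      open IsUnitalWith 𝟏-unital
      open Max (≤-totalOrder γ) using (x≤y⇒y⊔x≈y)

      private
        𝟏-unit : ∀ {a} → a ∈[ h ] → IsUnitAt a 𝟏
        𝟏-unit = unit-below-height multiassociativeAlgebra hasHeight isUnit

        π𝟏≈𝟏 : ∀ {a} → a ∈[ h ] → π a 𝟏 ≈ᴹ 𝟏
        π𝟏≈𝟏 {a} = π-𝟏 hasHeight a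

      π≈𝟏⇒barUnit : ∀ {a e} → a ∈[ h ] → π a e ≈ᴹ 𝟏 → IsBarUnit (M 𝓜) a e
      π≈𝟏⇒barUnit a∈[h] πe≈𝟏 x =
        ≈ᴹ-trans (⋆-cong ≈ᴹ-refl πe≈𝟏) (proj₂ (𝟏-unit a∈[h] x)) ,
        ≈ᴹ-trans (⋆-cong πe≈𝟏 ≈ᴹ-refl) (proj₁ (𝟏-unit a∈[h] x))

      -- Evaluate the bar-unit law at `𝟏`: πₐ e = 𝟏 ⋆ₐ πₐ e = 𝟏 ⊣ₐ e = 𝟏.
      barUnit⇒π≈𝟏 : ∀ {a e} → a ∈[ h ] → IsBarUnit (M 𝓜) a e → π a e ≈ᴹ 𝟏
      barUnit⇒π≈𝟏 {a} {e} a∈[h] e-bar =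
        ≈ᴹ-trans (≈ᴹ-sym (proj₁ (𝟏-unit a∈[h] (π a e)))) (proj₁ (e-bar 𝟏))

      𝟏-barUnit : ∀ a → a ∈[ h ] → IsBarUnit (M 𝓜) a 𝟏
      𝟏-barUnit a a∈[h] = π≈𝟏⇒barUnit a∈[h] (π𝟏≈𝟏 a∈[h])

      Halo-mono : ∀ a b → a ≤ b → b ∈[ h ] → Halo (M 𝓜) a ⊆ Halo (M 𝓜) b
      Halo-mono a b a≤b b∈[h] {e} e-bar = π≈𝟏⇒barUnit b∈[h] (begin
        π b e        ≡⟨ ≡.cong (λ d → π d e) (x≤y⇒y⊔x≈y a≤b) ⟨
        π (b ↑ a) e  ≈⟨ π-π b a e ⟨
        π b (π a e)  ≈⟨ π-cong (barUnit⇒π≈𝟏 (ℕ.≤-trans (s≤s a≤b) b∈[h]) e-bar) ⟩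
        π b 𝟏        ≈⟨ π𝟏≈𝟏 b∈[h] ⟩
        𝟏            ∎)
        where
        open import Relation.Binary.Reasoning.Setoid ≈ᴹ-setoid
        open IsModuleHomomorphism (π-linear b)
          renaming (⟦⟧-cong to π-cong)

      Span-Halo-isSubalgebra : ∀ a → IsSubalgebra (induced (M 𝓜) (interval a h))
                                                  (Span vectorSpace (Halo (M 𝓜) a))
      Span-Halo-isSubalgebra a = record
        { isSubmodule = Span-isSubmodule vectorSpace (Halo (M 𝓜) a)
        -- For ⊣ the right factor varies over the span, and the map is constantly `x` on the halo;
        -- for ⊢ the left factor varies, and the constant is `y`.
        ; ⊣-closed    = λ i {x} x∈ y∈ → closed
            (IsBilinear.linearʳ (⊣-bilinear (ι i)) x)
            (λ e-bar → proj₁ (Halo⊆ i e-bar x)) y∈ x∈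
        ; ⊢-closed    = λ i {_} {y} x∈ y∈ → closed
            (IsBilinear.linearˡ (⊢-bilinear (ι i)) y)
            (λ e-bar → proj₂ (Halo⊆ i e-bar y)) x∈ y∈
        }
        where
        open PluriassociativeAlgebra (M 𝓜) using (⊣-bilinear; ⊢-bilinear)

        ι : Fin ∣ interval a h ∣ → Fin γ
        ι = enumerate (interval a h)

        Halo⊆ : ∀ i → Halo (M 𝓜) a ⊆ Halo (M 𝓜) (ι i)
        Halo⊆ i = let a≤c , c∈[h] = ∈interval⇒bounds (enumerate-∈ (interval a h) i)
                  in Halo-mono a (ι i) a≤c c∈[h]

        closed : ∀ {f} → IsLinear vectorSpace f →
                 ∀ {y} → (∀ {e} → Halo (M 𝓜) a e → f e ≈ᴹ y) →
                 ∀ {x} → Span vectorSpace (Halo (M 𝓜) a) x →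
                 Span vectorSpace (Halo (M 𝓜) a) y →
                 Span vectorSpace (Halo (M 𝓜) a) (f x)
        closed f-linear f≈y x∈ y∈ =
          let s , fx≈sy = linear-const⇒scalar vectorSpace (Halo (M 𝓜) a) f-linear f≈y x∈
          in Span-respects vectorSpace (Halo (M 𝓜) a) (≈ᴹ-sym fx≈sy)
               (Span-*ₗ vectorSpace (Halo (M 𝓜) a) s y∈)

      -- Both 𝟏 ⊣ₐ x = 𝟏 ⋆ₐ πₐ x and x ⊢ₐ 𝟏 = πₐ x ⋆ₐ 𝟏 equal πₐ x, so the wire-unit law says
      -- exactly that πₐ fixes x.
      π-id⇔wireUnit : ∀ a → a ∈[ h ] →
                      (∀ x → π a x ≈ᴹ x) ⇔ IsWireUnit (M 𝓜) a 𝟏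
      π-id⇔wireUnit a a∈[h] = mk⇔
        (λ π-id x → ≈ᴹ-trans (proj₁ (𝟏-unit a∈[h] (π a x))) (π-id x) ,
                    ≈ᴹ-trans (proj₂ (𝟏-unit a∈[h] (π a x))) (π-id x))
        (λ 𝟏-wire x → ≈ᴹ-trans (≈ᴹ-sym (proj₁ (𝟏-unit a∈[h] (π a x))))
                               (proj₁ (𝟏-wire x)))

proposition3p3p3 : {c ℓ₁ ℓ₂ m ℓm : Level} (K : HeytingField c ℓ₁ ℓ₂) → CharacteristicZero K →
    (γ : ℕ) (𝓜 : MultiprojectionAlgebra K γ m ℓm) →
    let open MultiprojectionAlgebra 𝓜
    in
    (h : ℕ) → HasHeight h →
    (𝟏 : Carrierᴹ) → IsUnitalWith 𝟏 →
    (∀ a → a ∈[ h ] → IsBarUnit (M 𝓜) a 𝟏) ×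
    (∀ a b → a ≤ b → b ∈[ h ] → Halo (M 𝓜) a ⊆ Halo (M 𝓜) b) ×
    (∀ a → a ∈[ h ] →
    (∣ interval a h ∣ ≡ (h ∸ suc (toℕ a)) + 1) ×
    IsSubalgebra (induced (M 𝓜) (interval a h)) (Span vectorSpace (Halo (M 𝓜) a))) ×
    (∀ a → a ∈[ h ] → (∀ x → π a x ≈ᴹ x) ⇔ IsWireUnit (M 𝓜) a 𝟏)
proposition3p3p3 K char₀ γ 𝓜 h hasHeight 𝟏 𝟏-unital =
  𝟏-barUnit 𝓜 hasHeight 𝟏-unital ,
  Halo-mono 𝓜 hasHeight 𝟏-unital ,
  (λ a a∈[h] →
    -- As `h` is at most `γ`, the interval is not cut off by the end of `Fin γ`, so its size is the
    -- expected one.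
    ∣interval∣ a a∈[h] (height≤γ multiassociativeAlgebra hasHeight) ,
    Span-Halo-isSubalgebra 𝓜 hasHeight 𝟏-unital a) ,
  π-id⇔wireUnit 𝓜 hasHeight 𝟏-unital
  where open MultiprojectionAlgebra 𝓜 using (multiassociativeAlgebra)
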